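{- Let $\mathcal{S}$ be the class of all upper semicomputable functions $S$ on binary strings such that for each infinite binary sequence $\alpha$ and each $n$ there are fewer than $2^n$ prefixes $x$ of $\alpha$ with $S(x)<n$. There exists a minimal, up to an $O(1)$ additive term, function in $\mathcal{S}$ (that is, a function $S_0\in\mathcal{S}$ such that for every $S\in\mathcal{S}$ there is a constant $c$ with $S_0(x)\le S(x)+c$ for all $x$), and it coincides with the plain stopping time complexity $\mathrm{C}(x\mid x*)$ up to an $O(1)$ additive term.
   Context: A natural-valued function $S$ on binary strings is upper semicomputable if it is the pointwise limit of a decreasing sequence of uniformly computable total functions; equivalently, the set $\{(n,x) : S(x)<n\}$ is computably enumerable. A description mode is a set $D$ of triples $(p,x,y)$ of binary strings such that: (1) $D$ is computably enumerable; (2) for every $p$ and $x$ there is at most one $y$ such that $(p,x,y)\in D$; (3) if $(p,x,y)\in D$ and $x$ is a prefix of $x'$, then $(p,x',y)\in D$. For a description mode $D$ let $\mathrm{C}_D(y\mid x*)=\min\{|p| : (p,x,y)\in D\}$. There exists an optimal description mode, i.e., a $D$ such that $\mathrm{C}_D\le \mathrm{C}_{D'}+O(1)$ for every description mode $D'$; fix such a $D$ and write $\mathrm{C}(y\mid x*)$ for $\mathrm{C}_D(y\mid x*)$. The quantity $\mathrm{C}(x\mid x*)$, where the same string $x$ is used as object and as condition, is (up to $O(1)$) the plain stopping time complexity of $x$. -}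

module Defs where

open import Data.Nat using (ℕ; zero; suc; _+_; _*_; _^_; _≤_; _<_)
open import Data.Fin using (Fin)
open import Data.Bool using (Bool; true; false)
open import Data.List using (List; []; _∷_; length; applyUpTo)
open import Data.List.Relation.Unary.All using (All)
open import Data.List.Relation.Unary.Unique.Propositional using (Unique)
open import Data.List.Relation.Binary.Prefix.Heterogeneous using (Prefix)
open import Data.Vec using (Vec; []; _∷_; lookup)
open import Data.Product using (_×_; ∃; ∃-syntax)
open import Data.Sum using (_⊎_)
open import Function.Bundles using (_⇔_)
open import Relation.Nullary using (¬_)
open import Relation.Binary.PropositionalEquality using (_≡_)

BinString : Set
BinString = List Bool

_⊑_ : BinString → BinString → Set
x ⊑ y = Prefix _≡_ x y

-- Partial recursive (μ-recursive) functions of k arguments.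

data Rec : ℕ → Set where
  zero : ∀ {k} → Rec k
  succ : Rec 1
  proj : ∀ {k} → Fin k → Rec k
  comp : ∀ {k m} → Rec m → Vec (Rec k) m → Rec k
  prec : ∀ {k} → Rec k → Rec (2 + k) → Rec (suc k)
  mu   : ∀ {k} → Rec (suc k) → Rec k

infix 4 _[_]⇓_

-- f [ v ]⇓ r : the partial function f is defined on v, with value r.
data _[_]⇓_ : ∀ {k} → Rec k → Vec ℕ k → ℕ → Set where
  zero  : ∀ {k} {v : Vec ℕ k} → zero [ v ]⇓ 0
  succ  : ∀ {n} → succ [ n ∷ [] ]⇓ suc n
  proj  : ∀ {k} {v : Vec ℕ k} (i : Fin k) → proj i [ v ]⇓ lookup v i
  comp  : ∀ {k m} {f : Rec m} {gs : Vec (Rec k) m} {v : Vec ℕ k} {r}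
          (ws : Vec ℕ m) →
          (∀ i → lookup gs i [ v ]⇓ lookup ws i) →
          f [ ws ]⇓ r → comp f gs [ v ]⇓ r
  prec0 : ∀ {k} {f : Rec k} {g : Rec (2 + k)} {v : Vec ℕ k} {r} →
          f [ v ]⇓ r → prec f g [ 0 ∷ v ]⇓ r
  precS : ∀ {k} {f : Rec k} {g : Rec (2 + k)} {v : Vec ℕ k} {n q r} →
          prec f g [ n ∷ v ]⇓ q → g [ n ∷ q ∷ v ]⇓ r →
          prec f g [ suc n ∷ v ]⇓ r
  mu    : ∀ {k} {f : Rec (suc k)} {v : Vec ℕ k} {r} →
          f [ r ∷ v ]⇓ 0 →
          (∀ i → i < r → ∃[ y ] (f [ i ∷ v ]⇓ suc y)) →
          mu f [ v ]⇓ r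

-- Bijective base-2 numeration, a bijection between strings and ℕ.
code : BinString → ℕ
code []          = 0
code (false ∷ x) = 1 + 2 * code x
code (true  ∷ x) = 2 + 2 * code x

ComputableSequence : (ℕ → BinString) → Set
ComputableSequence f = ∃[ c ] (∀ t → c [ t ∷ [] ]⇓ code (f t))

UniformlyComputable : (ℕ → BinString → ℕ) → Set
UniformlyComputable s = ∃[ c ] (∀ t x → c [ t ∷ code x ∷ [] ]⇓ s t x)

-- A set of triples is c.e. if it is empty or the range of a total
-- computable function.
ComputablyEnumerable : (BinString → BinString → BinString → Set) → Set
ComputablyEnumerable A =
  (∀ p x y → ¬ A p x y) ⊎
  (∃[ f ] ∃[ g ] ∃[ h ]
     (ComputableSequence f × ComputableSequence g × ComputableSequence h ×
      (∀ p x y → A p x y ⇔ (∃[ t ] (f t ≡ p × g t ≡ x × h t ≡ y)))))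

-- A sequence of naturals converges iff it is eventually constant.
UpperSemicomputable : (BinString → ℕ) → Set
UpperSemicomputable S =
  ∃[ s ] (UniformlyComputable s ×
          (∀ t x → s (suc t) x ≤ s t x) ×
          (∀ x → ∃[ T ] (∀ t → T ≤ t → s t x ≡ S x)))

PrefixOf : (ℕ → Bool) → BinString → Set
PrefixOf α x = ∃[ k ] (x ≡ applyUpTo α k)

FewerThan : ℕ → (BinString → Set) → Set
FewerThan N P = ∀ xs → Unique xs → All P xs → length xs < N

𝒮 : (BinString → ℕ) → Set
𝒮 S = UpperSemicomputable S ×
      (∀ (α : ℕ → Bool) (n : ℕ) →
         FewerThan (2 ^ n) (λ x → PrefixOf α x × S x < n))

_≤⁺_ : (BinString → ℕ) → (BinString → ℕ) → Set
S ≤⁺ S′ = ∃[ c ] (∀ x → S x ≤ S′ x + c)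

record DescriptionMode (D : BinString → BinString → BinString → Set) : Set where
  field
    enumerable : ComputablyEnumerable D
    functional : ∀ {p x y y′} → D p x y → D p x y′ → y ≡ y′
    monotone   : ∀ {p x x′ y} → D p x y → x ⊑ x′ → D p x′ y

-- C[ D ] y ∣ x ≔ m : the minimum defining C_D(y | x*) exists and equals m.
-- It is a relation because the set of descriptions may be empty (value ∞)
-- and because the minimum is not computable.
C[_]_∣_≔_ : (BinString → BinString → BinString → Set) →
            BinString → BinString → ℕ → Set
C[ D ] y ∣ x ≔ m =
  (∃[ p ] (D p x y × length p ≡ m)) × (∀ p → D p x y → m ≤ length p)

-- C_D ≤ C_D′ + O(1), where ∞ is allowed as a value: only finite values of
-- C_D′ impose a condition, and there C_D has to be finite as well.
Optimal : (BinString → BinString → BinString → Set) → Set₁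
Optimal D =
  DescriptionMode D ×
  (∀ D′ → DescriptionMode D′ →
     ∃[ c ] (∀ x y m′ → C[ D′ ] y ∣ x ≔ m′ →
       ∃[ m ] ((C[ D ] y ∣ x ≔ m) × m ≤ m′ + c)))

{-# OPTIONS --safe #-}
module Submission where

-- S₀ x is the length of a shortest p with D p x x. It lies in 𝒮 because one p cannot describe two
-- distinct prefixes of the same sequence. For minimality, let the events (x , u) put x at the level
-- n = s u x + 1, where s approximates S, and colour the events of each level first-fit, so that
-- comparable distinct strings get different colours. First-fit is optimal on comparability graphs
-- of trees: a colour q forces q + 1 distinct strings of that level below a common string, hence
-- q + 1 < 2ⁿ. Coding the colour by a word of length n, which outputs x on every extension of x,
-- gives a description mode whose complexity C(x | x*) is exactly S x + 1.

open import Data.Bool using (Bool; true; false)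
open import Data.Fin using (Fin; zero; suc; fromℕ<)
open import Data.Fin.Patterns
open import Data.Fin.Properties using (fromℕ<-injective; injective⇒≤)
open import Data.List as List using (List; []; _∷_; length; _++_; applyUpTo)
open import Data.List.Membership.Propositional.Properties using (∈-lookup)
import Data.List.Relation.Binary.Pointwise as Pointwise
open import Data.List.Relation.Binary.Prefix.Heterogeneous using ([]; _∷_; _++ᵖ_)
open import Data.List.Relation.Binary.Prefix.Heterogeneous.Properties using (fromPointwise)
  renaming (trans to Prefix-trans)
open import Data.List.Relation.Unary.All as All using (All; []; _∷_)
open import Data.List.Relation.Unary.AllPairs using ([]; _∷_)
open import Data.List.Relation.Unary.Unique.Propositional using (Unique)
open import Data.Nat
open import Data.Nat.Properties
open import Data.Nat.Solver using (module +-*-Solver)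
open import Data.Product using (_×_; _,_; proj₁; proj₂; ∃-syntax)
open import Data.Sum using (_⊎_; inj₁; inj₂; [_,_]′; swap)
open import Data.Vec using (Vec; []; _∷_; lookup; tabulate)
open import Data.Vec.Properties using (lookup∘tabulate)
open import Defs
open import Function using (_∘_; id; mk⇔; Equivalence; _⇔_)
open import Relation.Binary.Definitions using (tri<; tri≈; tri>)
open import Relation.Binary.PropositionalEquality
open import Relation.Nullary using (¬_; Dec; contradiction)
open import Relation.Nullary.Decidable using (map′; decidable-stable)

-- Computability

record Computable {k} (f : Vec ℕ k → ℕ) : Set where
  field
    program : Rec k
    correct : ∀ v → program [ v ]⇓ f v

open Computable

-- Records rather than synonyms, so that the function can be inferred by unification.
record Computable* {k m} (F : Vec ℕ k → Vec ℕ m) : Set where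
  constructor components
  field component : ∀ i → Computable (λ v → lookup (F v) i)

record Computable₁ (f : ℕ → ℕ) : Set where
  constructor unary
  field computable : Computable {1} (λ v → f (lookup v 0F))

record Computable₂ (f : ℕ → ℕ → ℕ) : Set where
  constructor binary
  field computable : Computable {2} (λ v → f (lookup v 0F) (lookup v 1F))

open Computable*

computable-≗ : ∀ {k} {f g : Vec ℕ k → ℕ} → (∀ v → f v ≡ g v) → Computable f → Computable g
computable-≗ eq cf .program   = cf .program
computable-≗ eq cf .correct v = subst (cf .program [ v ]⇓_) (eq v) (cf .correct v)

var : ∀ {k} i → Computable {k} (λ v → lookup v i)
var i .program   = proj i
var i .correct v = proj i

substitute : ∀ {k m} {f : Vec ℕ m → ℕ} {F : Vec ℕ k → Vec ℕ m} →
             Computable f → Computable* F → Computable (λ v → f (F v))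
substitute cf cF .program = comp (cf .program) (tabulate (λ i → cF .component i .program))
substitute {F = F} cf cF .correct v =
  comp (F v)
    (λ i → subst (_[ v ]⇓ lookup (F v) i)
      (sym (lookup∘tabulate (λ j → cF .component j .program) i)) (cF .component i .correct v))
    (cf .correct (F v))

[]* : ∀ {k} → Computable* {k} (λ v → [])
[]* .component ()

infixr 5 _∷*_

_∷*_ : ∀ {k m} {f : Vec ℕ k → ℕ} {F : Vec ℕ k → Vec ℕ m} →
       Computable f → Computable* F → Computable* (λ v → f v ∷ F v)
(cf ∷* cF) .component zero    = cf
(cf ∷* cF) .component (suc i) = cF .component i

id* : ∀ {k} → Computable* {k} id
id* .component = var

app₁ : ∀ {k} {f : ℕ → ℕ} {g : Vec ℕ k → ℕ} →
       Computable₁ f → Computable g → Computable (λ v → f (g v))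
app₁ (unary cf) cg = substitute cf (cg ∷* []*)

app₂ : ∀ {k} {f : ℕ → ℕ → ℕ} {g h : Vec ℕ k → ℕ} →
       Computable₂ f → Computable g → Computable h → Computable (λ v → f (g v) (h v))
app₂ (binary cf) cg ch = substitute cf (cg ∷* ch ∷* []*)

primitiveRecursion : ∀ {k} {f : Vec ℕ (suc k) → ℕ} {b : Vec ℕ k → ℕ} {g : Vec ℕ (2 + k) → ℕ} →
                     Computable b → Computable g →
                     (∀ v → b v ≡ f (0 ∷ v)) → (∀ n v → g (n ∷ f (n ∷ v) ∷ v) ≡ f (suc n ∷ v)) →
                     Computable f
primitiveRecursion cb cg base step .program = prec (cb .program) (cg .program)
primitiveRecursion {f = f} cb cg base step .correct = λ { (n ∷ v) → go n v }
  where
  go : ∀ n v → prec (cb .program) (cg .program) [ n ∷ v ]⇓ f (n ∷ v)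
  go zero    v = subst (prec _ _ [ 0 ∷ v ]⇓_) (base v) (prec0 (cb .correct v))
  go (suc n) v = subst (prec _ _ [ suc n ∷ v ]⇓_) (step n v) (precS (go n v) (cg .correct _))

zero-computable : ∀ {k} → Computable {k} (λ v → 0)
zero-computable .program   = zero
zero-computable .correct v = zero

suc-computable : Computable₁ suc
suc-computable = unary (record { program = succ ; correct = λ { (n ∷ []) → succ } })

constant : ∀ {k} n → Computable {k} (λ v → n)
constant zero    = zero-computable
constant (suc n) = app₁ suc-computable (constant n)

+-computable : Computable₂ _+_
+-computable = binary (primitiveRecursion (var 0F) (app₁ suc-computable (var 1F))
                        (λ { (_ ∷ []) → refl }) (λ { _ (_ ∷ []) → refl }))

*-computable : Computable₂ _*_
*-computable = binary (primitiveRecursion zero-computable (app₂ +-computable (var 2F) (var 1F))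
                        (λ { (_ ∷ []) → refl }) (λ { _ (_ ∷ []) → refl }))

pred-computable : Computable₁ pred
pred-computable = unary (primitiveRecursion zero-computable (var 0F) (λ { [] → refl }) (λ { _ [] → refl }))

∸-computable : Computable₂ _∸_
∸-computable = binary (app₂ flipped (var 1F) (var 0F))
  where
  -- Primitive recursion runs on the first argument, so the subtrahend is put there.
  flipped : Computable₂ (λ n m → m ∸ n)
  flipped = binary (primitiveRecursion (var 0F) (app₁ pred-computable (var 1F))
                     (λ { (_ ∷ []) → refl }) (λ { n (m ∷ []) → pred[m∸n]≡m∸[1+n] m n }))

2^-computable : Computable₁ (2 ^_)
2^-computable = unary (primitiveRecursion (constant 1) (app₂ *-computable (constant 2) (var 1F))
                         (λ { [] → refl }) (λ { _ [] → refl }))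

-- The characteristic function takes the value 0 on P, as mu requires.
record Decides {k} (P : Vec ℕ k → Set) : Set where
  field
    χ            : Vec ℕ k → ℕ
    χ-computable : Computable χ
    sound        : ∀ v → χ v ≡ 0 → P v
    complete     : ∀ v → P v → χ v ≡ 0

  decide : ∀ v → Dec (P v)
  decide v = map′ (sound v) (complete v) (χ v ≟ 0)

open Decides

substituteᵈ : ∀ {k m} {P : Vec ℕ m → Set} {F : Vec ℕ k → Vec ℕ m} →
              Decides P → Computable* F → Decides (λ v → P (F v))
substituteᵈ {F = F} dP cF = record
  { χ            = λ v → dP .χ (F v)
  ; χ-computable = substitute (dP .χ-computable) cF
  ; sound        = λ v → dP .sound (F v)
  ; complete     = λ v → dP .complete (F v)
  }

decides-⇔ : ∀ {k} {P Q : Vec ℕ k → Set} → (∀ v → P v → Q v) → (∀ v → Q v → P v) →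
            Decides P → Decides Q
decides-⇔ P⇒Q Q⇒P dP = record
  { χ            = dP .χ
  ; χ-computable = dP .χ-computable
  ; sound        = λ v eq → P⇒Q v (dP .sound v eq)
  ; complete     = λ v q → dP .complete v (Q⇒P v q)
  }

infixr 3 _∧ᵈ_
infixr 2 _∨ᵈ_
infix  4 _≤ᵈ_ _≡ᵈ_

_≤ᵈ_ : ∀ {k} {f g : Vec ℕ k → ℕ} → Computable f → Computable g → Decides (λ v → f v ≤ g v)
_≤ᵈ_ {f = f} {g} cf cg = record
  { χ            = λ v → f v ∸ g v
  ; χ-computable = app₂ ∸-computable cf cg
  ; sound        = λ v → m∸n≡0⇒m≤n
  ; complete     = λ v → m≤n⇒m∸n≡0
  }

_∧ᵈ_ : ∀ {k} {P Q : Vec ℕ k → Set} → Decides P → Decides Q → Decides (λ v → P v × Q v)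
dP ∧ᵈ dQ = record
  { χ            = λ v → dP .χ v + dQ .χ v
  ; χ-computable = app₂ +-computable (dP .χ-computable) (dQ .χ-computable)
  ; sound        = λ v eq → dP .sound v (m+n≡0⇒m≡0 _ eq) , dQ .sound v (m+n≡0⇒n≡0 (dP .χ v) eq)
  ; complete     = λ v (p , q) → cong₂ _+_ (dP .complete v p) (dQ .complete v q)
  }

_∨ᵈ_ : ∀ {k} {P Q : Vec ℕ k → Set} → Decides P → Decides Q → Decides (λ v → P v ⊎ Q v)
dP ∨ᵈ dQ = record
  { χ            = λ v → dP .χ v * dQ .χ v
  ; χ-computable = app₂ *-computable (dP .χ-computable) (dQ .χ-computable)
  ; sound        = λ v eq → [ inj₁ ∘ dP .sound v , inj₂ ∘ dQ .sound v ]′ (m*n≡0⇒m≡0∨n≡0 (dP .χ v) eq)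
  ; complete     = λ { v (inj₁ p) → cong (_* dQ .χ v) (dP .complete v p)
                     ; v (inj₂ q) → trans (cong (dP .χ v *_) (dQ .complete v q)) (*-zeroʳ (dP .χ v)) }
  }

¬ᵈ_ : ∀ {k} {P : Vec ℕ k → Set} → Decides P → Decides (λ v → ¬ P v)
¬ᵈ dP = record
  { χ            = λ v → 1 ∸ dP .χ v
  ; χ-computable = app₂ ∸-computable (constant 1) (dP .χ-computable)
  ; sound        = λ v eq p → 1+n≢0 (trans (cong (1 ∸_) (sym (dP .complete v p))) eq)
  ; complete     = λ v ¬p → m≤n⇒m∸n≡0 (n≢0⇒n>0 (¬p ∘ dP .sound v))
  }

_≡ᵈ_ : ∀ {k} {f g : Vec ℕ k → ℕ} → Computable f → Computable g → Decides (λ v → f v ≡ g v)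
cf ≡ᵈ cg = decides-⇔ (λ v (f≤g , g≤f) → ≤-antisym f≤g g≤f) (λ v eq → ≤-reflexive eq , ≤-reflexive (sym eq))
             ((cf ≤ᵈ cg) ∧ᵈ (cg ≤ᵈ cf))

-- The characteristic function is the product of those of `P` at all `i < N v`, built by primitive
-- recursion; a product vanishes exactly when some factor does.
∃<ᵈ : ∀ {k} {P : Vec ℕ (suc k) → Set} {N : Vec ℕ k → ℕ} → Computable N → Decides P →
      Decides (λ v → ∃[ i ] (i < N v × P (i ∷ v)))
∃<ᵈ {k} {P} {N} cN dP = substituteᵈ {F = λ v → N v ∷ v} bounded (cN ∷* id*)
  where
  ψ : ℕ → Vec ℕ k → ℕ
  ψ zero    v = 1
  ψ (suc n) v = ψ n v * dP .χ (n ∷ v)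

  uncurried : Vec ℕ (suc k) → ℕ
  uncurried (n ∷ v) = ψ n v

  skip : Vec ℕ (2 + k) → Vec ℕ (suc k)
  skip (n ∷ _ ∷ v) = n ∷ v

  skip* : Computable* skip
  skip* .component zero    = computable-≗ (λ { (n ∷ _ ∷ v) → refl }) (var 0F)
  skip* .component (suc i) = computable-≗ (λ { (n ∷ _ ∷ v) → refl }) (var (suc (suc i)))

  ψ-sound : ∀ n v → ψ n v ≡ 0 → ∃[ i ] (i < n × P (i ∷ v))
  ψ-sound (suc n) v eq with m*n≡0⇒m≡0∨n≡0 (ψ n v) eq
  ... | inj₁ eq′ = let i , i<n , p = ψ-sound n v eq′ in i , m<n⇒m<1+n i<n , p
  ... | inj₂ eq′ = n , n<1+n n , dP .sound (n ∷ v) eq′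

  ψ-complete : ∀ n v {i} → i < n → P (i ∷ v) → ψ n v ≡ 0
  ψ-complete (suc n) v i<1+n p with m≤n⇒m<n∨m≡n (≤-pred i<1+n)
  ... | inj₁ i<n  = cong (_* dP .χ (n ∷ v)) (ψ-complete n v i<n p)
  ... | inj₂ refl = trans (cong (ψ n v *_) (dP .complete (n ∷ v) p)) (*-zeroʳ (ψ n v))

  Bounded : Vec ℕ (suc k) → Set
  Bounded (n ∷ v) = ∃[ i ] (i < n × P (i ∷ v))

  bounded : Decides Bounded
  bounded = record
    { χ            = uncurried
    ; χ-computable = primitiveRecursion (constant 1)
        (app₂ *-computable (var 1F) (substitute (dP .χ-computable) skip*)) (λ _ → refl) (λ _ _ → refl)
    ; sound        = λ { (n ∷ v) → ψ-sound n v }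
    ; complete     = λ { (n ∷ v) (i , i<n , p) → ψ-complete n v i<n p }
    }

-- Unbounded search

leastZero : ∀ (f : ℕ → ℕ) n → f n ≡ 0 → ∃[ m ] (f m ≡ 0 × (∀ i → i < m → ∃[ y ] f i ≡ suc y))
leastZero f zero    eq = 0 , eq , λ i ()
leastZero f (suc n) eq with f 0 in eq₀
... | zero  = 0 , eq₀ , λ i ()
... | suc y = let m , z , below = leastZero (f ∘ suc) n eq
              in suc m , z , λ { zero _ → y , eq₀ ; (suc i) (s≤s i<m) → below i i<m }

module Minimise {k} {P : Vec ℕ (suc k) → Set} (dP : Decides P) (witness : ∀ v → ∃[ n ] P (n ∷ v)) where
  private
    search : ∀ v → ∃[ m ] (dP .χ (m ∷ v) ≡ 0 × (∀ i → i < m → ∃[ y ] dP .χ (i ∷ v) ≡ suc y))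
    search v = let n , p = witness v in leastZero (λ i → dP .χ (i ∷ v)) n (dP .complete (n ∷ v) p)

  abstract
    least : Vec ℕ k → ℕ
    least v = proj₁ (search v)

    least-satisfies : ∀ v → P (least v ∷ v)
    least-satisfies v = dP .sound _ (proj₁ (proj₂ (search v)))

    least-minimal : ∀ v {n} → P (n ∷ v) → least v ≤ n
    least-minimal v {n} p = ≮⇒≥ λ n<least →
      let y , eq = proj₂ (proj₂ (search v)) n n<least
      in 1+n≢0 (trans (sym eq) (dP .complete (n ∷ v) p))

    least-computable : Computable least
    least-computable .program   = mu (dP .χ-computable .program)
    least-computable .correct v = let m , eq , below = search v in
      mu (subst (dP .χ-computable .program [ m ∷ v ]⇓_) eq (dP .χ-computable .correct (m ∷ v)))
         (λ i i<m → let y , eq′ = below i i<m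
                    in y , subst (dP .χ-computable .program [ i ∷ v ]⇓_) eq′ (dP .χ-computable .correct (i ∷ v)))

-- Searching for the least point of the graph over `v` finds `f v`, the only one there.
graphDecidable⇒computable : ∀ {k} {f : Vec ℕ k → ℕ} {P : Vec ℕ (suc k) → Set} → Decides P →
                            (∀ v → P (f v ∷ v)) → (∀ v {n} → P (n ∷ v) → n ≡ f v) → Computable f
graphDecidable⇒computable {f = f} dP holds unique =
  computable-≗ (λ v → unique v (least-satisfies v)) least-computable
  where open Minimise dP (λ v → f v , holds v)

-- Pairing and binary strings

pair : ℕ → ℕ → ℕ
pair a b = (a + b) * (a + b) + a

pair-computable : Computable₂ pair
pair-computable = binary (app₂ +-computable (app₂ *-computable sum sum) (var 0F))
  where sum = app₂ +-computable (var 0F) (var 1F)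

-- s² + a with a ≤ s lies in [s², (s+1)²), which determines s and then a.
square-offset-mono : ∀ {s a t b} → a ≤ s → s < t → s * s + a < t * t + b
square-offset-mono {s} {a} {t} {b} a≤s s<t = begin-strict
  s * s + a      ≤⟨ +-monoʳ-≤ (s * s) a≤s ⟩
  s * s + s      ≡⟨ +-comm (s * s) s ⟩
  suc s * s      <⟨ *-monoʳ-< (suc s) (n<1+n s) ⟩
  suc s * suc s  ≤⟨ *-mono-≤ s<t s<t ⟩
  t * t          ≤⟨ m≤m+n (t * t) b ⟩
  t * t + b      ∎
  where open ≤-Reasoning

pair-injective : ∀ a b a′ b′ → pair a b ≡ pair a′ b′ → a ≡ a′ × b ≡ b′
pair-injective a b a′ b′ eq with <-cmp (a + b) (a′ + b′)
... | tri< s<s′ _ _ = contradiction eq (<⇒≢ (square-offset-mono {b = a′} (m≤m+n a b) s<s′))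
... | tri> _ _ s′<s = contradiction (sym eq) (<⇒≢ (square-offset-mono {b = a} (m≤m+n a′ b′) s′<s))
... | tri≈ _ s≡s′ _ = a≡a′ , +-cancelˡ-≡ a b b′ (trans s≡s′ (cong (_+ b′) (sym a≡a′)))
  where
  a≡a′ : a ≡ a′
  a≡a′ = +-cancelˡ-≡ ((a + b) * (a + b)) a a′ (trans eq (cong (λ s → s * s + a′) (sym s≡s′)))

m≤m*m : ∀ m → m ≤ m * m
m≤m*m zero    = z≤n
m≤m*m (suc m) = m≤m+n (suc m) _

first-≤-pair : ∀ a b → a ≤ pair a b
first-≤-pair a b = m≤n+m a ((a + b) * (a + b))

second-≤-pair : ∀ a b → b ≤ pair a b
second-≤-pair a b = ≤-trans (m≤n+m b a) (≤-trans (m≤m*m (a + b)) (m≤m+n _ a))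

-- The disjunct a ≡ z makes both projections total, with values at most z.
FirstGraph SecondGraph : Vec ℕ 2 → Set
FirstGraph v  = lookup v 0F ≡ lookup v 1F ⊎ ∃[ b ] (b < suc (lookup v 1F) × pair (lookup v 0F) b ≡ lookup v 1F)
SecondGraph v = lookup v 0F ≡ lookup v 1F ⊎ ∃[ a ] (a < suc (lookup v 1F) × pair a (lookup v 0F) ≡ lookup v 1F)

abstract
  firstGraph : Decides FirstGraph
  firstGraph = (var 0F ≡ᵈ var 1F) ∨ᵈ
    ∃<ᵈ (app₁ suc-computable (var 1F)) (app₂ pair-computable (var 1F) (var 0F) ≡ᵈ var 2F)

  secondGraph : Decides SecondGraph
  secondGraph = (var 0F ≡ᵈ var 1F) ∨ᵈ
    ∃<ᵈ (app₁ suc-computable (var 1F)) (app₂ pair-computable (var 0F) (var 1F) ≡ᵈ var 2F)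

firstGraph-total : ∀ v → ∃[ a ] FirstGraph (a ∷ v)
firstGraph-total (z ∷ []) = z , inj₁ refl

secondGraph-total : ∀ v → ∃[ b ] SecondGraph (b ∷ v)
secondGraph-total (z ∷ []) = z , inj₁ refl

module First  = Minimise firstGraph firstGraph-total
module Second = Minimise secondGraph secondGraph-total

first second : ℕ → ℕ
first  z = First.least (z ∷ [])
second z = Second.least (z ∷ [])

first-computable : Computable₁ first
first-computable = unary (computable-≗ (λ { (z ∷ []) → refl }) First.least-computable)

second-computable : Computable₁ second
second-computable = unary (computable-≗ (λ { (z ∷ []) → refl }) Second.least-computable)

first-≤ : ∀ z → first z ≤ z
first-≤ z = First.least-minimal (z ∷ []) (inj₁ refl)

second-≤ : ∀ z → second z ≤ z
second-≤ z = Second.least-minimal (z ∷ []) (inj₁ refl)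

first-pair : ∀ a b → first (pair a b) ≡ a
first-pair a b with First.least-satisfies (pair a b ∷ [])
... | inj₂ (b′ , _ , eq) = proj₁ (pair-injective (first (pair a b)) b′ a b eq)
-- Here the search ended at the default value `pair a b`. Since `a` lies in the graph as well,
-- minimality bounds the result by `a`, and `a ≤ pair a b` gives the converse.
... | inj₁ eq = ≤-antisym
  (First.least-minimal (pair a b ∷ []) (inj₂ (b , s≤s (second-≤-pair a b) , refl)))
  (≤-trans (first-≤-pair a b) (≤-reflexive (sym eq)))

second-pair : ∀ a b → second (pair a b) ≡ b
second-pair a b with Second.least-satisfies (pair a b ∷ [])
... | inj₂ (a′ , _ , eq) = proj₂ (pair-injective a′ (second (pair a b)) a b eq)
... | inj₁ eq = ≤-antisym
  (Second.least-minimal (pair a b ∷ []) (inj₂ (a , s≤s (first-≤-pair a b) , refl)))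
  (≤-trans (second-≤-pair a b) (≤-reflexive (sym eq)))

code-injective : ∀ x y → code x ≡ code y → x ≡ y
code-injective []          []          eq = refl
code-injective []          (false ∷ y) ()
code-injective []          (true ∷ y)  ()
code-injective (false ∷ x) []          ()
code-injective (true ∷ x)  []          ()
code-injective (false ∷ x) (false ∷ y) eq =
  cong (false ∷_) (code-injective x y (*-cancelˡ-≡ _ _ 2 (suc-injective eq)))
code-injective (true ∷ x)  (true ∷ y)  eq =
  cong (true ∷_) (code-injective x y (*-cancelˡ-≡ _ _ 2 (suc-injective (suc-injective eq))))
code-injective (false ∷ x) (true ∷ y)  eq = contradiction (suc-injective eq) (even≢odd (code x) (code y))
code-injective (true ∷ x)  (false ∷ y) eq = contradiction (sym (suc-injective eq)) (even≢odd (code y) (code x))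

-- Successor in bijective base 2, least significant digit first: `false` is the digit 1, `true` is
-- the digit 2, and incrementing a 2 leaves a 1 and carries.
next : BinString → BinString
next []          = false ∷ []
next (false ∷ x) = true ∷ x
next (true ∷ x)  = false ∷ next x

code-next : ∀ x → code (next x) ≡ suc (code x)
code-next []          = refl
code-next (false ∷ x) = refl
code-next (true ∷ x)  = cong suc (trans (cong (2 *_) (code-next x)) (*-suc 2 (code x)))

decode : ℕ → BinString
decode zero    = []
decode (suc n) = next (decode n)

code-decode : ∀ n → code (decode n) ≡ n
code-decode zero    = refl
code-decode (suc n) = trans (code-next (decode n)) (cong suc (code-decode n))

decode-code : ∀ x → decode (code x) ≡ x
decode-code x = code-injective _ _ (code-decode (code x))

decode-injective : ∀ {m n} → decode m ≡ decode n → m ≡ n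
decode-injective {m} {n} eq = trans (sym (code-decode m)) (trans (cong code eq) (code-decode n))

-- The first letter is the least significant digit, so appending `y` shifts its code by `length x`
-- places. This turns the prefix relation into an arithmetic equation.
code-++ : ∀ x y → code (x ++ y) ≡ code x + 2 ^ length x * code y
code-++ []          y = sym (+-identityʳ (code y))
code-++ (false ∷ x) y rewrite code-++ x y =
  solve 3 (λ a b c → con 1 :+ con 2 :* (a :+ b :* c) := con 1 :+ con 2 :* a :+ con 2 :* b :* c)
    refl (code x) (2 ^ length x) (code y)
  where open +-*-Solver
code-++ (true ∷ x)  y rewrite code-++ x y =
  solve 3 (λ a b c → con 2 :+ con 2 :* (a :+ b :* c) := con 2 :+ con 2 :* a :+ con 2 :* b :* c)
    refl (code x) (2 ^ length x) (code y)
  where open +-*-Solver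

2^length≤1+code : ∀ x → 2 ^ length x ≤ suc (code x)
2^length≤1+code []          = ≤-refl
2^length≤1+code (false ∷ x) = ≤-trans (*-monoʳ-≤ 2 (2^length≤1+code x)) (≤-reflexive (*-suc 2 (code x)))
2^length≤1+code (true ∷ x)  =
  ≤-trans (*-monoʳ-≤ 2 (2^length≤1+code x)) (≤-trans (≤-reflexive (*-suc 2 (code x))) (n≤1+n _))

2+code≤2^1+length : ∀ x → 2 + code x ≤ 2 ^ suc (length x)
2+code≤2^1+length []          = ≤-refl
2+code≤2^1+length (false ∷ x) = ≤-trans (n≤1+n _)
  (≤-trans (≤-reflexive (sym (*-distribˡ-+ 2 2 (code x)))) (*-monoʳ-≤ 2 (2+code≤2^1+length x)))
2+code≤2^1+length (true ∷ x)  =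
  ≤-trans (≤-reflexive (sym (*-distribˡ-+ 2 2 (code x)))) (*-monoʳ-≤ 2 (2+code≤2^1+length x))

-- The intervals from `2 ^ l - 1` to `2 ^ (l + 1) - 2` are disjoint for different `l`, so the two
-- inequalities are a decidable description of the graph of the length.
length-unique : ∀ x {l} → 2 ^ l ≤ suc (code x) → 2 + code x ≤ 2 ^ suc l → l ≡ length x
length-unique x {l} lower upper = ≤-antisym
  (bracket lower (2+code≤2^1+length x)) (bracket (2^length≤1+code x) upper)
  where
  bracket : ∀ {m n} → 2 ^ m ≤ suc (code x) → suc (code x) < 2 ^ suc n → m ≤ n
  bracket lo up = ≮⇒≥ λ n<m → <⇒≱ up (≤-trans (^-monoʳ-≤ 2 n<m) lo)

length-decode-computable : Computable₁ (λ n → length (decode n))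
length-decode-computable = unary (graphDecidable⇒computable
  ((app₁ 2^-computable (var 0F) ≤ᵈ app₁ suc-computable (var 1F)) ∧ᵈ
   (app₂ +-computable (constant 2) (var 1F) ≤ᵈ app₁ 2^-computable (app₁ suc-computable (var 0F))))
  (λ { (n ∷ []) → let x = decode n in
       subst (λ c → 2 ^ length x ≤ suc c × 2 + c ≤ 2 ^ suc (length x)) (code-decode n)
             (2^length≤1+code x , 2+code≤2^1+length x) })
  (λ { (n ∷ []) {l} bounds →
       let lower , upper = subst (λ c → 2 ^ l ≤ suc c × 2 + c ≤ 2 ^ suc l) (sym (code-decode n)) bounds
       in length-unique (decode n) lower upper }))

⊑⇒++ : ∀ {x y} → x ⊑ y → ∃[ z ] x ++ z ≡ y
⊑⇒++ []           = _ , refl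
⊑⇒++ (refl ∷ x⊑y) = let z , eq = ⊑⇒++ x⊑y in z , cong (_ ∷_) eq

⊑-refl : ∀ {x} → x ⊑ x
⊑-refl = fromPointwise (Pointwise.refl refl)

⊑-trans : ∀ {x y z} → x ⊑ y → y ⊑ z → x ⊑ z
⊑-trans = Prefix-trans trans

⊑-comparable : ∀ {x y z} → x ⊑ z → y ⊑ z → x ⊑ y ⊎ y ⊑ x
⊑-comparable []         _          = inj₁ []
⊑-comparable (_ ∷ _)    []         = inj₂ []
⊑-comparable (refl ∷ p) (refl ∷ q) with ⊑-comparable p q
... | inj₁ x⊑y = inj₁ (refl ∷ x⊑y)
... | inj₂ y⊑x = inj₂ (refl ∷ y⊑x)

-- By `code-++`, being a prefix means that some suffix code solves an equation. `suffix-bound` shows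
-- that a solution is at most the code of the longer string, so a bounded search suffices.
_⊑ᵈ_ : ∀ {k} {f g : Vec ℕ k → ℕ} → Computable f → Computable g → Decides (λ v → decode (f v) ⊑ decode (g v))
_⊑ᵈ_ {f = f} {g} cf cg = decides-⇔ {Q = λ v → decode (f v) ⊑ decode (g v)}
  (λ { v (w , _ , eq) → subst (decode (f v) ⊑_)
         (code-injective (decode (f v) ++ decode w) _ (trans (code-decode-++ (f v) (decode w))
           (trans (cong (λ c → f v + 2 ^ length (decode (f v)) * c) (code-decode w))
             (trans eq (sym (code-decode (g v)))))))
         (⊑-refl ++ᵖ decode w) })
  (λ v p → let z , eq = ⊑⇒++ p
               eq′ = trans (sym (code-decode-++ (f v) z)) (trans (cong code eq) (code-decode (g v)))
           in code z , s≤s (subst (code z ≤_) eq′ (suffix-bound (f v) (length (decode (f v))) (code z))) , eq′)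
  (substituteᵈ {F = λ v → f v ∷ g v ∷ []}
    (∃<ᵈ (app₁ suc-computable (var 1F))
      (app₂ +-computable (var 1F)
        (app₂ *-computable (app₁ 2^-computable (app₁ length-decode-computable (var 1F))) (var 0F)) ≡ᵈ var 2F))
    (cf ∷* cg ∷* []*))
  where
  code-decode-++ : ∀ a z → code (decode a ++ z) ≡ a + 2 ^ length (decode a) * code z
  code-decode-++ a z = trans (code-++ (decode a) z)
                             (cong (_+ 2 ^ length (decode a) * code z) (code-decode a))

  suffix-bound : ∀ a l c → c ≤ a + 2 ^ l * c
  suffix-bound a l c = ≤-trans (m≤n*m c (2 ^ l) {{m^n≢0 2 l}}) (m≤n+m _ a)

-- First-fit colouring

-- The history h codes the colours of t-1, ..., 0, in this order, as nested pairs.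
module FirstFit (Conflict : ℕ → ℕ → Set)
                (conflict : Decides {2} (λ v → Conflict (lookup v 0F) (lookup v 1F))) where

  drop : ℕ → ℕ → ℕ
  drop zero    h = h
  drop (suc d) h = second (drop d h)

  drop-computable : Computable₂ drop
  drop-computable = binary (primitiveRecursion (var 0F) (app₁ second-computable (var 1F))
                             (λ { (_ ∷ []) → refl }) (λ { _ (_ ∷ []) → refl }))

  drop-≤ : ∀ d h → drop d h ≤ h
  drop-≤ zero    h = ≤-refl
  drop-≤ (suc d) h = ≤-trans (second-≤ (drop d h)) (drop-≤ d h)

  -- The history lists the latest colour first, so the colour of `i` lies `t - 1 - i` places deep.
  entry : ℕ → ℕ → ℕ → ℕ
  entry i t h = first (drop (t ∸ suc i) h)

  Blocked : Vec ℕ 3 → Set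
  Blocked v = let q = lookup v 0F ; t = lookup v 1F ; h = lookup v 2F in
    ∃[ i ] (i < t × Conflict i t × entry i t h ≡ q)

  abstract
    blocked : Decides Blocked
    blocked = ∃<ᵈ (var 1F)
      (substituteᵈ {F = λ v → lookup v 0F ∷ lookup v 2F ∷ []} conflict (var 0F ∷* var 2F ∷* []*) ∧ᵈ
       (app₁ first-computable
         (app₂ drop-computable (app₂ ∸-computable (var 2F) (app₁ suc-computable (var 0F))) (var 3F))
        ≡ᵈ var 1F))

  -- Projections never exceed the number they are applied to, so every entry of `h` is at most `h`,
  -- and the colour `suc h` is free. This holds for any number `h`, not only for genuine histories,
  -- so the search is total.
  unblocked-exists : ∀ v → ∃[ q ] ¬ Blocked (q ∷ v)
  unblocked-exists (t ∷ h ∷ []) = suc h , λ { (i , _ , _ , eq) →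
    1+n≰n (subst (_≤ h) eq (≤-trans (first-≤ (drop (t ∸ suc i) h)) (drop-≤ (t ∸ suc i) h))) }

  module Fresh = Minimise (¬ᵈ blocked) unblocked-exists

  history : ℕ → ℕ
  history zero    = 0
  history (suc t) = pair (Fresh.least (t ∷ history t ∷ [])) (history t)

  colour : ℕ → ℕ
  colour t = Fresh.least (t ∷ history t ∷ [])

  history-computable : Computable₁ history
  history-computable = unary (primitiveRecursion zero-computable
    (app₂ pair-computable (substitute Fresh.least-computable (var 0F ∷* var 1F ∷* []*)) (var 1F))
    (λ { [] → refl }) (λ { _ [] → refl }))

  colour-computable : Computable₁ colour
  colour-computable = unary (substitute Fresh.least-computable
    (var 0F ∷* app₁ history-computable (var 0F) ∷* []*))

  drop-history : ∀ d m → drop d (history (d + m)) ≡ history m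
  drop-history zero    m = refl
  drop-history (suc d) m = begin
    second (drop d (history (suc d + m)))  ≡⟨ cong (second ∘ drop d ∘ history) (+-suc d m) ⟨
    second (drop d (history (d + suc m)))  ≡⟨ cong second (drop-history d (suc m)) ⟩
    second (history (suc m))               ≡⟨ second-pair (colour m) (history m) ⟩
    history m                              ∎
    where open ≡-Reasoning

  entry-history : ∀ {i t} → i < t → entry i t (history t) ≡ colour i
  entry-history {i} {t} i<t = begin
    first (drop (t ∸ suc i) (history t))
      ≡⟨ cong (first ∘ drop (t ∸ suc i) ∘ history) (m∸n+n≡m i<t) ⟨
    first (drop (t ∸ suc i) (history (t ∸ suc i + suc i)))
      ≡⟨ cong first (drop-history (t ∸ suc i) (suc i)) ⟩
    first (history (suc i))
      ≡⟨ first-pair (colour i) (history i) ⟩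
    colour i ∎
    where open ≡-Reasoning

  colour-proper : ∀ {i t} → i < t → Conflict i t → colour i ≢ colour t
  colour-proper {i} {t} i<t c eq =
    Fresh.least-satisfies (t ∷ history t ∷ []) (i , i<t , c , trans (entry-history i<t) eq)

  -- By minimality a smaller colour cannot be unblocked, and decidability of `Blocked` removes the
  -- double negation.
  colour-least : ∀ t {q} → q < colour t → ∃[ i ] (Conflict i t × colour i ≡ q)
  colour-least t {q} q<colour =
    let i , i<t , c , eq = decidable-stable (decide blocked (q ∷ t ∷ history t ∷ []))
                             (<⇒≱ q<colour ∘ Fresh.least-minimal (t ∷ history t ∷ []))
    in i , c , trans (sym (entry-history i<t)) eq

-- Chains of comparable strings

Comparable : BinString → BinString → Set
Comparable x y = x ⊑ y ⊎ y ⊑ x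

-- Repeated events of one string at one level do not conflict. They may share a colour, so that
-- colours are bounded by the number of distinct strings, which is what `𝒮` counts.
LevelConflict : (ℕ → BinString) → (ℕ → ℕ) → ℕ → ℕ → Set
LevelConflict item level i t = level i ≡ level t × item i ≢ item t × Comparable (item i) (item t)

module TreeColouring
  (item : ℕ → BinString) (level : ℕ → ℕ) (colour : ℕ → ℕ)
  (proper : ∀ {i t} → i < t → LevelConflict item level i t → colour i ≢ colour t)
  (least  : ∀ t {q} → q < colour t → ∃[ i ] (LevelConflict item level i t × colour i ≡ q))
  where

  conflict⇒≢ : ∀ {i t} → LevelConflict item level i t → colour i ≢ colour t
  conflict⇒≢ {i} {t} c@(eq , x≢y , x~y) with <-cmp i t
  ... | tri< i<t _ _  = proper i<t c
  ... | tri≈ _ refl _ = contradiction refl x≢y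
  ... | tri> _ _ t<i  = proper t<i (sym eq , x≢y ∘ sym , swap x~y) ∘ sym

  -- If the colour of `i` were smaller, some `j` of that colour would block it at `t`. As `i` and
  -- `t` carry the same string, `j` would conflict with `i` too, contradicting properness.
  same-item⇒≤ : ∀ {i t} → level i ≡ level t → item i ≡ item t → colour t ≤ colour i
  same-item⇒≤ {i} {t} l≡ x≡ = ≮⇒≥ λ i<t →
    let j , (lj≡ , xj≢ , xj~) , eq = least t i<t
    in conflict⇒≢ ( trans lj≡ (sym l≡)
                  , (λ xj≡ → xj≢ (trans xj≡ x≡))
                  , subst (Comparable (item j)) (sym x≡) xj~) eq

  same-item⇒≡ : ∀ {i t} → level i ≡ level t → item i ≡ item t → colour i ≡ colour t
  same-item⇒≡ l≡ x≡ = ≤-antisym (same-item⇒≤ (sym l≡) (sym x≡)) (same-item⇒≤ l≡ x≡)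

  -- The lower bound `m` on the colour is what later keeps a newly added string of smaller colour
  -- distinct from `x`.
  Above : ℕ → ℕ → BinString → Set
  Above n m x = ∃[ j ] (item j ≡ x × level j ≡ n × m ≤ colour j)

  -- A colour below that of the longest element of a chain is blocked there by something
  -- comparable with it, hence with the whole chain.
  chain : ∀ t d m → d + m ≡ colour t →
          ∃[ e ] ∃[ xs ] (level e ≡ level t × m ≤ colour e × length xs ≡ suc d × Unique xs ×
                          All (λ x → x ⊑ item e × Above (level t) m x) xs)
  chain t zero m refl =
    t , item t ∷ [] , refl , ≤-refl , refl , [] ∷ [] , (⊑-refl , t , refl , refl , ≤-refl) ∷ []
  chain t (suc d) m d+m≡
    with e , xs , le≡ , m<e , len , unique , all ← chain t d (suc m) (trans (+-suc d m) d+m≡)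
    with i , (li≡ , xi≢ , xi~) , ci≡ ← least e m<e = extend xi~
    where
    li≡n : level i ≡ level t
    li≡n = trans li≡ le≡

    weaken : ∀ {x} → Above (level t) (suc m) x → Above (level t) m x
    weaken (j , xj , lj , m<j) = j , xj , lj , <⇒≤ m<j

    new : Above (level t) m (item i)
    new = i , refl , li≡n , ≤-reflexive (sym ci≡)

    -- At a fixed level the colour depends on the string alone; the new string has colour `m`, and
    -- the old ones have larger colours.
    distinct : ∀ {x} → Above (level t) (suc m) x → item i ≢ x
    distinct (j , xj , lj , m<j) xi≡ = <⇒≢ m<j
      (trans (sym ci≡) (same-item⇒≡ (trans li≡n (sym lj)) (trans xi≡ (sym xj))))

    unique′ : Unique (item i ∷ xs)
    unique′ = All.map (λ { (_ , a) → distinct a }) all ∷ unique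

    extend : Comparable (item i) (item e) → _
    -- If the new string is a prefix of `item e`, then `e` remains the longest element; otherwise
    -- `i` takes its place.
    extend (inj₁ i⊑e) = e , item i ∷ xs , le≡ , <⇒≤ m<e , cong suc len , unique′ ,
      (i⊑e , new) ∷ All.map (λ { (x⊑e , a) → x⊑e , weaken a }) all
    extend (inj₂ e⊑i) = i , item i ∷ xs , li≡n , ≤-reflexive (sym ci≡) , cong suc len , unique′ ,
      (⊑-refl , new) ∷ All.map (λ { (x⊑e , a) → ⊑-trans x⊑e e⊑i , weaken a }) all

-- Description modes

code-computable⇒computableSequence : ∀ f → Computable₁ (code ∘ f) → ComputableSequence f
code-computable⇒computableSequence f (unary cf) = cf .program , λ t → cf .correct (t ∷ [])

computableSequence⇒code-computable : ∀ f → ComputableSequence f → Computable₁ (code ∘ f)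
computableSequence⇒code-computable f (c , correct-c) =
  unary (record { program = c ; correct = λ { (t ∷ []) → correct-c t } })

decode-sequence : ∀ f → Computable₁ f → ComputableSequence (decode ∘ f)
decode-sequence f (unary cf) =
  code-computable⇒computableSequence (decode ∘ f) (unary (computable-≗ (λ v → sym (code-decode _)) cf))

applyUpTo-⊑ : ∀ (α : ℕ → Bool) {k l} → k ≤ l → applyUpTo α k ⊑ applyUpTo α l
applyUpTo-⊑ α z≤n       = []
applyUpTo-⊑ α (s≤s k≤l) = refl ∷ applyUpTo-⊑ (α ∘ suc) k≤l

prefixes-comparable : ∀ {α x y} → PrefixOf α x → PrefixOf α y → Comparable x y
prefixes-comparable {α} (k , refl) (l , refl) with ≤-total k l
... | inj₁ k≤l = inj₁ (applyUpTo-⊑ α k≤l)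
... | inj₂ l≤k = inj₂ (applyUpTo-⊑ α l≤k)

-- Extends a finite string to an infinite sequence, since the condition of `𝒮` speaks only of
-- prefixes of sequences.
pad : BinString → ℕ → Bool
pad []      k       = false
pad (b ∷ z) zero    = b
pad (b ∷ z) (suc k) = pad z k

⊑⇒prefixOf-pad : ∀ {x z} → x ⊑ z → PrefixOf (pad z) x
⊑⇒prefixOf-pad []         = 0 , refl
⊑⇒prefixOf-pad (refl ∷ p) = let k , eq = ⊑⇒prefixOf-pad p in suc k , cong (_ ∷_) eq

-- From a function in `𝒮` to a description mode

module Assignment {S : BinString → ℕ} (S∈𝒮 : 𝒮 S) where

  private
    s : ℕ → BinString → ℕ
    s = proj₁ (proj₁ S∈𝒮)

    s-program : UniformlyComputable s
    s-program = proj₁ (proj₂ (proj₁ S∈𝒮))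

    s-decreasing : ∀ t x → s (suc t) x ≤ s t x
    s-decreasing = proj₁ (proj₂ (proj₂ (proj₁ S∈𝒮)))

    s-converges : ∀ x → ∃[ T ] (∀ t → T ≤ t → s t x ≡ S x)
    s-converges = proj₂ (proj₂ (proj₂ (proj₁ S∈𝒮)))

    s-antitone : ∀ d t x → s (d + t) x ≤ s t x
    s-antitone zero    t x = ≤-refl
    s-antitone (suc d) t x = ≤-trans (s-decreasing (d + t) x) (s-antitone d t x)

    S≤s : ∀ t x → S x ≤ s t x
    S≤s t x = let T , eq = s-converges x
              in ≤-trans (≤-reflexive (sym (eq (T + t) (m≤m+n T t)))) (s-antitone T t x)

    s-decode-computable : Computable₂ (λ t n → s t (decode n))
    s-decode-computable = binary (record
      { program = proj₁ s-program
      ; correct = λ { (t ∷ n ∷ []) → subst (λ c → proj₁ s-program [ t ∷ c ∷ [] ]⇓ s t (decode n))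
                                           (code-decode n) (proj₂ s-program t (decode n)) }
      })

  item : ℕ → BinString
  item t = decode (first t)

  -- The successor turns `S x ≤ s u x` into `S x < level`, the strict inequality under which `𝒮`
  -- counts prefixes.
  level : ℕ → ℕ
  level t = suc (s (second t) (item t))

  level-computable : Computable₁ level
  level-computable = unary (app₁ suc-computable
    (app₂ s-decode-computable (app₁ second-computable (var 0F)) (app₁ first-computable (var 0F))))

  Conflict : ℕ → ℕ → Set
  Conflict = LevelConflict item level

  abstract
    conflict : Decides {2} (λ v → Conflict (lookup v 0F) (lookup v 1F))
    conflict = (app₁ level-computable (var 0F) ≡ᵈ app₁ level-computable (var 1F)) ∧ᵈ
      decides-⇔ (λ v first≢ → first≢ ∘ decode-injective) (λ v item≢ → item≢ ∘ cong decode) (¬ᵈ (x ≡ᵈ y)) ∧ᵈ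
      ((x ⊑ᵈ y) ∨ᵈ (y ⊑ᵈ x))
      where
      x : Computable {2} (λ v → first (lookup v 0F))
      x = app₁ first-computable (var 0F)

      y : Computable {2} (λ v → first (lookup v 1F))
      y = app₁ first-computable (var 1F)

  open FirstFit Conflict conflict using (colour; colour-computable; colour-proper; colour-least)
  open TreeColouring item level colour colour-proper colour-least using (conflict⇒≢; chain)

  -- `chain` with `m = 0` yields `colour t + 1` distinct prefixes of one string, all put at the
  -- level of `t` by some event, so `S` is below that level on each. Padding the string gives a
  -- sequence to which the bound of `𝒮` applies.
  colour-bound : ∀ t → suc (colour t) < 2 ^ level t
  colour-bound t =
    let e , xs , _ , _ , len , unique , all = chain t (colour t) 0 (+-identityʳ (colour t))
    in subst (_< 2 ^ level t) len
         (proj₂ S∈𝒮 (pad (item e)) (level t) xs unique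
           (All.map (λ { {x} (x⊑e , j , xj , lj , _) → ⊑⇒prefixOf-pad x⊑e ,
                         subst (S x <_) lj (s≤s (subst (λ y → S y ≤ s (second j) (item j)) xj
                           (S≤s (second j) (item j)))) }) all))

  -- The codes of the strings of length l are those from 2 ^ l - 1 to 2 ^ (l + 1) - 2.
  wordCode : ℕ → ℕ
  wordCode t = pred (2 ^ level t) + colour t

  wordCode-computable : Computable₁ wordCode
  wordCode-computable = unary (app₂ +-computable
    (app₁ pred-computable (app₁ 2^-computable (app₁ level-computable (var 0F))))
    (app₁ colour-computable (var 0F)))

  word : ℕ → BinString
  word t = decode (wordCode t)

  -- Adding the colour to the first code of a word of length `level t` stays within the
  -- `2 ^ level t` codes of that length, by `colour-bound`.
  length-word : ∀ t → length (word t) ≡ level t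
  length-word t = sym (length-unique (word t)
    (subst (λ c → N ≤ suc c) (sym (code-decode (wordCode t)))
      (≤-trans (≤-reflexive (sym 1+pred)) (s≤s (m≤m+n (pred N) (colour t)))))
    (subst (λ c → 2 + c ≤ 2 * N) (sym (code-decode (wordCode t))) upper))
    where
    N : ℕ
    N = 2 ^ level t

    1+pred : suc (pred N) ≡ N
    1+pred = suc-pred N {{m^n≢0 2 (level t)}}

    upper : 2 + wordCode t ≤ 2 * N
    upper = begin
      2 + (pred N + colour t)            ≡⟨ +-suc (suc (pred N)) (colour t) ⟨
      suc (pred N) + suc (colour t)      ≤⟨ +-mono-≤ (≤-reflexive 1+pred) (<⇒≤ (colour-bound t)) ⟩
      N + N                              ≡⟨ cong (N +_) (+-identityʳ N) ⟨
      2 * N                              ∎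
      where open ≤-Reasoning

  -- A word determines the level, as its length, and then the colour. Comparable distinct items with
  -- the same word would thus be in conflict and have equal colours.
  word-conflict : ∀ {i t} → Comparable (item i) (item t) → word i ≡ word t → item i ≡ item t
  word-conflict {i} {t} x~ w≡ = decidable-stable (map′ (cong decode) decode-injective (first i ≟ first t))
    λ x≢ → conflict⇒≢ (l≡ , x≢ , x~) c≡
    where
    l≡ : level i ≡ level t
    l≡ = trans (sym (length-word i)) (trans (cong length w≡) (length-word t))

    c≡ : colour i ≡ colour t
    c≡ = +-cancelˡ-≡ (pred (2 ^ level i)) _ _
      (trans (decode-injective w≡) (cong (λ l → pred (2 ^ l) + colour t) (sym l≡)))

  Mode : BinString → BinString → BinString → Set
  Mode p x y = ∃[ t ] (word t ≡ p × item t ≡ y × item t ⊑ x)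

  -- The number `r` codes an event together with an arbitrary suffix, so a single total sequence
  -- runs through all extensions of all items.
  extension : ℕ → BinString
  extension r = item (first r) ++ decode (second r)

  extension-sequence : ComputableSequence extension
  extension-sequence = code-computable⇒computableSequence extension (unary (computable-≗
    (λ v → sym (trans (code-++ (item (first (lookup v 0F))) (decode (second (lookup v 0F))))
                 (cong₂ (λ a b → a + 2 ^ length (item (first (lookup v 0F))) * b)
                        (code-decode (first (first (lookup v 0F)))) (code-decode (second (lookup v 0F))))))
    (app₂ +-computable a (app₂ *-computable (app₁ 2^-computable (app₁ length-decode-computable a)) b))))
    where
    a : Computable {1} (λ v → first (first (lookup v 0F)))
    a = app₁ first-computable (app₁ first-computable (var 0F))

    b : Computable {1} (λ v → second (lookup v 0F))
    b = app₁ second-computable (var 0F)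

  mode-enumerable : ComputablyEnumerable Mode
  mode-enumerable = inj₂ (word ∘ first , extension , item ∘ first ,
    decode-sequence (wordCode ∘ first) (unary (app₁ wordCode-computable (app₁ first-computable (var 0F)))) ,
    extension-sequence ,
    decode-sequence (first ∘ first) (unary (app₁ first-computable (app₁ first-computable (var 0F)))) ,
    λ p x y → mk⇔
      (λ { (t , w≡ , y≡ , ⊑x) → let z , ++≡ = ⊑⇒++ ⊑x in
           pair t (code z) ,
           trans (cong word (first-pair t (code z))) w≡ ,
           trans (cong₂ _++_ (cong item (first-pair t (code z)))
                             (trans (cong decode (second-pair t (code z))) (decode-code z))) ++≡ ,
           trans (cong item (first-pair t (code z))) y≡ })
      (λ { (r , w≡ , x≡ , y≡) → first r , w≡ , y≡ ,
           subst (item (first r) ⊑_) x≡ (⊑-refl ++ᵖ decode (second r)) }))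

  mode : DescriptionMode Mode
  mode = record
    { enumerable = mode-enumerable
    -- Both items are prefixes of the same condition, hence comparable.
    ; functional = λ { (i , wi , yi , ⊑x) (t , wt , yt , ⊑x′) →
        trans (sym yi) (trans (word-conflict (⊑-comparable ⊑x ⊑x′) (trans wi (sym wt))) yt) }
    ; monotone   = λ { (t , w , y , ⊑x) x⊑x′ → t , w , y , ⊑-trans ⊑x x⊑x′ }
    }

  -- The minimum is attained by the event of `x` at a stage where `s` has reached its limit. No word
  -- for `x` is shorter, because every approximation is at least `S x`.
  complexity : ∀ x → C[ Mode ] x ∣ x ≔ suc (S x)
  complexity x =
    (word t , (t , refl , item≡ , subst (_⊑ x) (sym item≡) ⊑-refl) ,
      trans (length-word t) (cong suc (trans (cong₂ s (second-pair (code x) T) item≡) (s≡S T ≤-refl)))) ,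
    λ { p (i , w≡ , y≡ , _) → subst (suc (S x) ≤_) (trans (sym (length-word i)) (cong length w≡))
          (s≤s (subst (λ y → S y ≤ s (second i) (item i)) y≡ (S≤s (second i) (item i)))) }
    where
    T : ℕ
    T = proj₁ (s-converges x)

    s≡S : ∀ t → T ≤ t → s t x ≡ S x
    s≡S = proj₂ (s-converges x)

    t : ℕ
    t = pair (code x) T

    item≡ : item t ≡ x
    item≡ = trans (cong decode (first-pair (code x) T)) (decode-code x)

lookup-injective : ∀ {A : Set} {xs : List A} → Unique xs → ∀ i j → List.lookup xs i ≡ List.lookup xs j → i ≡ j
lookup-injective (x∉ ∷ unique) zero    zero    eq = refl
lookup-injective (x∉ ∷ unique) zero    (suc j) eq = contradiction eq (All.lookup x∉ (∈-lookup j))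
lookup-injective (x∉ ∷ unique) (suc i) zero    eq = contradiction (sym eq) (All.lookup x∉ (∈-lookup i))
lookup-injective (x∉ ∷ unique) (suc i) (suc j) eq = cong suc (lookup-injective unique i j eq)

module Identity where

  -- Each string describes itself under every condition. Comparison with this mode makes the optimal
  -- complexity finite and at most the length plus a constant.
  Mode : BinString → BinString → BinString → Set
  Mode p x y = p ≡ y

  mode : DescriptionMode Mode
  mode = record
    { enumerable = inj₂ (decode ∘ first , decode ∘ second , decode ∘ first ,
        decode-sequence first first-computable , decode-sequence second second-computable ,
        decode-sequence first first-computable ,
        λ p x y → mk⇔
          (λ p≡y → pair (code p) (code x) ,
            trans (cong decode (first-pair (code p) (code x))) (decode-code p) ,
            trans (cong decode (second-pair (code p) (code x))) (decode-code x) ,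
            trans (cong decode (first-pair (code p) (code x))) (trans (decode-code p) p≡y))
          (λ { (t , f≡p , _ , f≡y) → trans (sym f≡p) f≡y }))
    ; functional = λ p≡y p≡y′ → trans (sym p≡y) p≡y′
    ; monotone   = λ p≡y _ → p≡y
    }

  complexity : ∀ x y → C[ Mode ] y ∣ x ≔ length y
  complexity x y = (y , refl , refl) , λ p p≡y → ≤-reflexive (cong length (sym p≡y))

-- Membership of C(x | x*) in `𝒮`

module StoppingTime {D : BinString → BinString → BinString → Set} (D-mode : DescriptionMode D)
                    {K : BinString → ℕ} (K-complexity : ∀ x → C[ D ] x ∣ x ≔ K x)
                    {b : ℕ} (K-bound : ∀ x → K x ≤ length x + b) where

  open DescriptionMode D-mode

  K≤length : ∀ {p x} → D p x x → K x ≤ length p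
  K≤length {p} {x} = proj₂ (K-complexity x) p

  -- Distinct prefixes of `α` have distinct shortest programs, and only `2 ^ n - 1` strings are
  -- shorter than `n`; their codes are the numbers below `2 ^ n - 1`.
  few-prefixes : ∀ α n → FewerThan (2 ^ n) (λ x → PrefixOf α x × K x < n)
  few-prefixes α n xs unique all =
    subst (length xs <_) (suc-pred (2 ^ n) {{m^n≢0 2 n}}) (s≤s (injective⇒≤ {f = index} index-injective))
    where
    element : Fin (length xs) → BinString
    element = List.lookup xs

    prefix : ∀ i → PrefixOf α (element i)
    prefix i = proj₁ (All.lookup all (∈-lookup i))

    program-of : BinString → BinString
    program-of x = proj₁ (proj₁ (K-complexity x))

    describes : ∀ x → D (program-of x) x x
    describes x = proj₁ (proj₂ (proj₁ (K-complexity x)))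

    code-bound : ∀ i → code (program-of (element i)) < pred (2 ^ n)
    code-bound i = <⇒≤pred (≤-trans (2+code≤2^1+length (program-of (element i)))
      (^-monoʳ-≤ 2 (subst (_< n) (sym (proj₂ (proj₂ (proj₁ (K-complexity (element i))))))
                                 (proj₂ (All.lookup all (∈-lookup i))))))

    index : Fin (length xs) → Fin (pred (2 ^ n))
    index i = fromℕ< (code-bound i)

    -- Monotonicity carries both descriptions to the longer of the two strings as condition, where
    -- functionality identifies the outputs.
    same-program : ∀ x y → Comparable x y → program-of x ≡ program-of y → x ≡ y
    same-program x y (inj₁ x⊑y) eq =
      functional (subst (λ p → D p y x) eq (monotone (describes x) x⊑y)) (describes y)
    same-program x y (inj₂ y⊑x) eq =
      functional (describes x) (subst (λ p → D p x y) (sym eq) (monotone (describes y) y⊑x))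

    index-injective : ∀ {i j} → index i ≡ index j → i ≡ j
    index-injective {i} {j} eq = lookup-injective unique i j
      (same-program (element i) (element j) (prefixes-comparable (prefix i) (prefix j))
        (code-injective _ _ (fromℕ<-injective _ _ (code-bound i) (code-bound j) eq)))

  module Approximation
    {f g h : ℕ → BinString}
    (f-seq : ComputableSequence f) (g-seq : ComputableSequence g) (h-seq : ComputableSequence h)
    (enumerates : ∀ p x y → D p x y ⇔ (∃[ t ] (f t ≡ p × g t ≡ x × h t ≡ y))) where

    -- Phrased through codes, because programs compute with the codes of strings only.
    Description : ℕ → ℕ → ℕ → Set
    Description m n i = length (decode (code (f i))) ≡ m × code (g i) ≡ n × code (h i) ≡ n

    -- The first disjunct is a computable upper bound for `K`. It gives the approximation a value
    -- before any description of the string has been enumerated.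
    Bound : Vec ℕ 3 → Set
    Bound v = let m = lookup v 0F ; t = lookup v 1F ; n = lookup v 2F in
      m ≡ length (decode n) + b ⊎ ∃[ i ] (i < t × Description m n i)

    abstract
      bound : Decides Bound
      bound =
        (var 0F ≡ᵈ app₂ +-computable (app₁ length-decode-computable (var 2F)) (constant b)) ∨ᵈ
        ∃<ᵈ (var 1F)
          ((app₁ length-decode-computable (app₁ (computableSequence⇒code-computable f f-seq) (var 0F)) ≡ᵈ var 1F) ∧ᵈ
           (app₁ (computableSequence⇒code-computable g g-seq) (var 0F) ≡ᵈ var 3F) ∧ᵈ
           (app₁ (computableSequence⇒code-computable h h-seq) (var 0F) ≡ᵈ var 3F))

    bound-exists : ∀ v → ∃[ m ] Bound (m ∷ v)
    bound-exists (t ∷ n ∷ []) = length (decode n) + b , inj₁ refl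

    open Minimise bound bound-exists

    approximation : ℕ → BinString → ℕ
    approximation t x = least (t ∷ code x ∷ [])

    decreasing : ∀ t x → approximation (suc t) x ≤ approximation t x
    decreasing t x = least-minimal (suc t ∷ code x ∷ []) (weaken (least-satisfies (t ∷ code x ∷ [])))
      where
      weaken : ∀ {m} → Bound (m ∷ t ∷ code x ∷ []) → Bound (m ∷ suc t ∷ code x ∷ [])
      weaken (inj₁ eq)            = inj₁ eq
      weaken (inj₂ (i , i<t , d)) = inj₂ (i , m<n⇒m<1+n i<t , d)

    K≤bound : ∀ {t x} m → Bound (m ∷ t ∷ code x ∷ []) → K x ≤ m
    K≤bound {x = x} m (inj₁ eq) =
      subst (K x ≤_) (sym (trans eq (cong (λ y → length y + b) (decode-code x)))) (K-bound x)
    K≤bound {x = x} m (inj₂ (i , _ , len , g≡ , h≡)) =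
      subst (K x ≤_) (trans (cong length (sym (decode-code (f i)))) len)
        (K≤length (Equivalence.from (enumerates (f i) x x)
          (i , refl , code-injective _ _ g≡ , code-injective _ _ h≡)))

    converges : ∀ x → ∃[ T ] (∀ t → T ≤ t → approximation t x ≡ K x)
    converges x =
      let (p , Dpxx , len) , _ = K-complexity x
          i , f≡ , g≡ , h≡     = Equivalence.to (enumerates p x x) Dpxx
      -- Index `i` enumerates a shortest description, which is taken into account from stage `i + 1`
      -- on.
      in suc i , λ t i<t → ≤-antisym
           (least-minimal (t ∷ code x ∷ [])
             (inj₂ (i , i<t , trans (cong length (trans (decode-code (f i)) f≡)) len , cong code g≡ , cong code h≡)))
           (K≤bound (approximation t x) (least-satisfies (t ∷ code x ∷ [])))

    upperSemicomputable : UpperSemicomputable K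
    upperSemicomputable = approximation ,
      (least-computable .program , λ t x → least-computable .correct (t ∷ code x ∷ [])) ,
      decreasing , converges

  upperSemicomputable : UpperSemicomputable K
  upperSemicomputable with enumerable
  -- The empty string has a finite complexity, so `D` contains at least one triple.
  ... | inj₁ empty = contradiction (proj₁ (proj₂ (proj₁ (K-complexity [])))) (empty _ [] [])
  ... | inj₂ (f , g , h , f-seq , g-seq , h-seq , enumerates) =
    Approximation.upperSemicomputable f-seq g-seq h-seq enumerates

  K∈𝒮 : 𝒮 K
  K∈𝒮 = upperSemicomputable , few-prefixes

-- Minimality of C(x | x*)

theorem5 : ∀ (D : BinString → BinString → BinString → Set) → Optimal D →
    ∃[ S₀ ] (𝒮 S₀ ×
    (∀ (S : BinString → ℕ) → 𝒮 S → S₀ ≤⁺ S) ×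
    (∃[ c ] (∀ x → ∃[ m ] ((C[ D ] x ∣ x ≔ m) × S₀ x ≤ m + c × m ≤ S₀ x + c))))
theorem5 D (D-mode , optimal) =
  -- The minimal function is C(x | x*) itself, so the two coincide with additive constant `0`.
  K , StoppingTime.K∈𝒮 D-mode K-complexity (λ x → proj₂ (proj₂ (finite x))) , minimal ,
  0 , λ x → K x , K-complexity x , m≤m+n (K x) 0 , m≤m+n (K x) 0
  where
  b : ℕ
  b = proj₁ (optimal Identity.Mode Identity.mode)

  -- Optimality, applied to the identity mode, makes the uncomputable minimum C(x | x*) available
  -- as a function of x.
  finite : ∀ x → ∃[ m ] ((C[ D ] x ∣ x ≔ m) × m ≤ length x + b)
  finite x = proj₂ (optimal Identity.Mode Identity.mode) x x (length x) (Identity.complexity x x)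

  K : BinString → ℕ
  K x = proj₁ (finite x)

  K-complexity : ∀ x → C[ D ] x ∣ x ≔ K x
  K-complexity x = proj₁ (proj₂ (finite x))

  minimal : ∀ S → 𝒮 S → K ≤⁺ S
  minimal S S∈𝒮 =
    let c , compare = optimal (Assignment.Mode S∈𝒮) (Assignment.mode S∈𝒮)
    -- The complexity in the mode built from `S` is `S x + 1`; its extra unit is absorbed into the
    -- constant.
    in suc c , λ x →
      let m , ((p , Dpxx , len) , _) , m≤ = compare x x (suc (S x)) (Assignment.complexity S∈𝒮 x)
      in begin
        K x            ≤⟨ proj₂ (K-complexity x) p Dpxx ⟩
        length p       ≡⟨ len ⟩
        m              ≤⟨ m≤ ⟩
        suc (S x) + c  ≡⟨ +-suc (S x) c ⟨
        S x + suc c    ∎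
    where open ≤-Reasoning
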